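{- For every positive integer $n$, Statement $\mathrm{P}(n)$ implies Statement $\mathrm{A}(n)$, where: $\mathrm{A}(n)$: for every separable polynomial $f(x)\in\mathbf{Z}[x]$ of degree $n$, every good prime $p$ for $f(x)$, and every integer $m$ coprime to $p$, there exist infinitely many elements $d\in\mathcal{S}(f)$ such that $d\equiv m\pmod p$. $\mathrm{P}(n)$: for every separable polynomial $h(x)\in\mathbf{Z}[x]$ of degree $n$ whose leading coefficient is a square, every good prime $p$ for $h(x)$, and every integer $m$ coprime to $p$, there exist infinitely many primes $q\in\mathcal{S}(h)$ such that $q\equiv m\pmod p$.
   Context: Squarefree integers may be negative and are nonzero. For a nonzero rational number $r$, its squarefree part $S(r)$ is the unique squarefree integer $d$ such that $r/d$ is a square in $\mathbf{Q}$. For a separable nonconstant $f(x)\in\mathbf{Z}[x]$, $\mathcal{S}(f)=\{S(f(r)) : r\in\mathbf{Q},\ f(r)\neq 0\}$. An odd prime $p$ is good for $f(x)$ if the reduced polynomial $\bar f(x)\in\mathbf{F}_p[x]$ has the same degree as $f(x)$ and has nonzero discriminant. Primes are positive. -}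

module Defs where

open import Algebra.Bundles using (CommutativeRing; Semiring)
open import Data.Fin.Base using (Fin; zero; suc; toℕ; punchIn; splitAt)
open import Data.Integer.Base as ℤ using (ℤ; +_; 0ℤ; ∣_∣)
open import Data.Integer.Coprimality using (Coprime)
open import Data.Integer.Divisibility.Signed as ℤ∣ using (_∣_)
import Data.Integer.Properties as ℤ
open import Data.Integer.Tactic.RingSolver using (solve-∀)
open import Data.List.Base using (List; []; _∷_; map)
open import Data.List.Membership.Propositional using (_∉_)
open import Data.Nat.Base as ℕ using (ℕ; zero; suc; NonZero)
import Data.Nat.Properties as ℕ
import Data.Nat.DivMod as ℕ
open import Data.Nat.Primality using (Prime)
open import Data.Product.Base using (Σ; ∃; ∃₂; _×_; _,_)
open import Data.Rational.Base as ℚ using (ℚ; 0ℚ)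
import Data.Rational.Properties as ℚ
open import Data.Rational.Unnormalised.Base using (mkℚᵘ; *≡*)
open import Data.Sum.Base using (inj₁; inj₂; [_,_]′)
open import Function.Base using (case_of_; id)
open import Level using (Level; 0ℓ)
open import Relation.Binary.PropositionalEquality as ≡ using (_≡_; _≢_)
open import Relation.Nullary.Negation using (¬_)

module Polynomials {c ℓ : Level} (R : CommutativeRing c ℓ) where

  open CommutativeRing R hiding (zero)
  open import Algebra.Definitions.RawSemiring (Semiring.rawSemiring semiring) using (_^_)
  open import Algebra.Definitions.RawMonoid +-rawMonoid using (sum)
    renaming (_×_ to _·_)
  open import Algebra.Properties.Semiring.Sum semiring
    using (sum-cong-≋; *-distribˡ-sum)
  open import Relation.Binary.Reasoning.Setoid setoid

  -- Coefficients in increasing order of degree.  Trailing zeros are allowed: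
  -- polynomials are compared coefficientwise by _≈ₚ_, and the degree is read
  -- off the coefficients by HasDegree.
  Poly : Set c
  Poly = List Carrier

  coeff : Poly → ℕ → Carrier
  coeff []      _       = 0#
  coeff (a ∷ f) zero    = a
  coeff (a ∷ f) (suc i) = coeff f i

  infix 4 _≈ₚ_
  _≈ₚ_ : Poly → Poly → Set ℓ
  f ≈ₚ g = ∀ i → coeff f i ≈ coeff g i

  HasDegree : ℕ → Poly → Set ℓ
  HasDegree n f = ¬ (coeff f n ≈ 0#) × (∀ i → n ℕ.< i → coeff f i ≈ 0#)

  eval : Poly → Carrier → Carrier
  eval []      x = 0#
  eval (a ∷ f) x = a + x * eval f x

  infixl 6 _+ₚ_
  _+ₚ_ : Poly → Poly → Poly
  []      +ₚ g       = g
  (a ∷ f) +ₚ []      = a ∷ f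
  (a ∷ f) +ₚ (b ∷ g) = (a + b) ∷ (f +ₚ g)

  infixl 7 _*ₚ_
  _*ₚ_ : Poly → Poly → Poly
  []      *ₚ g = []
  (a ∷ f) *ₚ g = map (a *_) g +ₚ (0# ∷ (f *ₚ g))

  scaleFrom : ℕ → Poly → Poly
  scaleFrom i []      = []
  scaleFrom i (a ∷ f) = (i · a) ∷ scaleFrom (suc i) f

  derivative : Poly → Poly
  derivative []      = []
  derivative (_ ∷ f) = scaleFrom 1 f

  -- gcd(f , f′) = 1 in Bézout form; meant for R a field.
  CoprimeToDerivative : Poly → Set (c Level.⊔ ℓ)
  CoprimeToDerivative f =
    ∃₂ λ u v → (u *ₚ f) +ₚ (v *ₚ derivative f) ≈ₚ (1# ∷ [])

  Matrix : ℕ → Set c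
  Matrix n = Fin n → Fin n → Carrier

  sign : ℕ → Carrier
  sign i = (- 1#) ^ i

  minor : ∀ {n} → Matrix (suc n) → Fin (suc n) → Matrix n
  minor M i r s = M (punchIn i r) (suc s)

  -- Expansion along the first column.
  det : ∀ {n} → Matrix n → Carrier
  det {zero}  M = 1#
  det {suc n} M = sum λ i → sign (toℕ i) * (M i zero * det (minor M i))

  -- The row (aₘ , aₘ₋₁ , … , a₀ , 0 , 0 , …), where aᵢ = coeff f i.
  descending : ℕ → Poly → ℕ → Carrier
  descending m       f zero    = coeff f m
  descending zero    f (suc j) = 0#
  descending (suc m) f (suc j) = descending m f j

  shifted : ℕ → (ℕ → Carrier) → (ℕ → Carrier)
  shifted zero    r j       = r j
  shifted (suc i) r zero    = 0#
  shifted (suc i) r (suc j) = shifted i r j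

  -- Sylvester matrix of f and g in formal degrees m and n:
  -- n shifted rows of f followed by m shifted rows of g.
  sylvester : ∀ m n → Poly → Poly → Matrix (n ℕ.+ m)
  sylvester m n f g i j =
    [ (λ k → shifted (toℕ k) (descending m f) (toℕ j))
    , (λ k → shifted (toℕ k) (descending n g) (toℕ j)) ]′ (splitAt n i)

  resultant : ∀ m n → Poly → Poly → Carrier
  resultant m n f g = det (sylvester m n f g)

  -- In degree n with leading coefficient a, the first column of the Sylvester
  -- matrix of f and f′ is a times the column with entries 1 (first row of f),
  -- n (first row of f′) and 0 elsewhere.
  dividedColumn : ∀ k → Fin (k ℕ.+ suc k) → Carrier
  dividedColumn k i =
    [ (λ { zero → 1#          ; (suc _) → 0# })
    , (λ { zero → suc k · 1#  ; (suc _) → 0# }) ]′ (splitAt k i)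

  replaceFirstColumn : ∀ {n} → (Fin n → Carrier) → Matrix n → Matrix n
  replaceFirstColumn v M i zero    = v i
  replaceFirstColumn v M i (suc j) = M i (suc j)

  -- The discriminant (-1)^(n(n-1)/2) a⁻¹ Res(f , f′) of a polynomial of degree
  -- n ≥ 1 with leading coefficient a.  The factor a is removed from the first
  -- column of the Sylvester matrix instead of being divided out, so the formula
  -- makes sense over any commutative ring; see leading*disc below.
  -- The derivative has formal degree n - 1 even if n vanishes in the ring.
  disc : (n : ℕ) .{{_ : NonZero n}} → Poly → Carrier
  disc n@(suc k) f =
    sign ((n ℕ.* k) ℕ./ 2) *
    det (replaceFirstColumn (dividedColumn k) (sylvester n k f (derivative f)))

  private

    ·-zeroʳ : ∀ n → n · 0# ≈ 0#
    ·-zeroʳ zero    = refl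
    ·-zeroʳ (suc n) = trans (+-identityˡ _) (·-zeroʳ n)

    *-·-1# : ∀ a n → a * (n · 1#) ≈ n · a
    *-·-1# a zero    = zeroʳ a
    *-·-1# a (suc n) =
      trans (distribˡ a 1# (n · 1#)) (+-cong (*-identityʳ a) (*-·-1# a n))

    coeff-scaleFrom : ∀ j f i → coeff (scaleFrom j f) i ≈ (i ℕ.+ j) · coeff f i
    coeff-scaleFrom j []      i       = sym (·-zeroʳ (i ℕ.+ j))
    coeff-scaleFrom j (a ∷ f) zero    = refl
    coeff-scaleFrom j (a ∷ f) (suc i) =
      trans (coeff-scaleFrom (suc j) f i)
            (reflexive (≡.cong (_· coeff f i) (ℕ.+-suc i j)))

    coeff-derivative : ∀ f i → coeff (derivative f) i ≈ suc i · coeff f (suc i)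
    coeff-derivative []      i = sym (·-zeroʳ (suc i))
    coeff-derivative (a ∷ f) i =
      trans (coeff-scaleFrom 1 f i)
            (reflexive (≡.cong (_· coeff f i) (ℕ.+-comm i 1)))

    x*[y*z]≈y*[x*z] : ∀ x y z → x * (y * z) ≈ y * (x * z)
    x*[y*z]≈y*[x*z] x y z =
      trans (sym (*-assoc x y z)) (trans (*-congʳ (*-comm x y)) (*-assoc y x z))

    *-det : ∀ {n} .{{_ : NonZero n}} a (v : Fin n → Carrier) (M : Matrix n) →
            (∀ i j → toℕ j ≡ 0 → a * v i ≈ M i j) →
            a * det (replaceFirstColumn v M) ≈ det M
    *-det {suc n} a v M col = begin
      a * sum (λ i → sign (toℕ i) * (v i * det (minor M i)))
        ≈⟨ *-distribˡ-sum {suc n} a (λ i → sign (toℕ i) * (v i * det (minor M i))) ⟩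
      sum (λ i → a * (sign (toℕ i) * (v i * det (minor M i))))
        ≈⟨ sum-cong-≋ {suc n} (λ i → term (sign (toℕ i)) (det (minor M i)) i) ⟩
      det M ∎
      where
      term : ∀ s d i → a * (s * (v i * d)) ≈ s * (M i zero * d)
      term s d i = trans (x*[y*z]≈y*[x*z] a s (v i * d))
        (*-congˡ (trans (sym (*-assoc a (v i) d)) (*-congʳ (col i zero ≡.refl))))

    k+1+k≢0 : ∀ k → NonZero (k ℕ.+ suc k)
    k+1+k≢0 zero    = _
    k+1+k≢0 (suc k) = _

  leading*disc : ∀ k f → let n = suc k in
    coeff f n * disc n f ≈
    sign ((n ℕ.* k) ℕ./ 2) * resultant n k f (derivative f)
  leading*disc k f =
    trans (x*[y*z]≈y*[x*z] _ _ _)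
          (*-congˡ (*-det {{k+1+k≢0 k}} _ (dividedColumn k) _ column))
    where
    column : ∀ i (j : Fin (k ℕ.+ suc k)) → toℕ j ≡ 0 →
             coeff f (suc k) * dividedColumn k i ≈
             sylvester (suc k) k f (derivative f) i j
    column i j j≡0 rewrite j≡0 with splitAt k i
    ... | inj₁ zero    = *-identityʳ _
    ... | inj₁ (suc _) = zeroʳ _
    ... | inj₂ zero    = trans (*-·-1# _ (suc k)) (descending-0 k)
      where
      descending-0 : ∀ k → suc k · coeff f (suc k) ≈ descending k (derivative f) 0
      descending-0 k = sym (trans (reflexive (lemma k)) (coeff-derivative f k))
        where
        lemma : ∀ k → descending k (derivative f) 0 ≡ coeff (derivative f) k
        lemma zero    = ≡.refl
        lemma (suc k) = ≡.refl
    ... | inj₂ (suc _) = zeroʳ _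

-- F_p as a setoid: the integers up to congruence modulo p.  The reduction map
-- is then the identity on representatives.  (A field when p is prime.)
infix 4 _≡_[mod_]
_≡_[mod_] : ℤ → ℤ → ℕ → Set
a ≡ b [mod p ] = + p ∣ a ℤ.- b

𝔽 : ℕ → CommutativeRing 0ℓ 0ℓ
𝔽 p = record
  { Carrier           = ℤ
  ; _≈_               = _≡_[mod p ]
  ; _+_               = ℤ._+_
  ; _*_               = ℤ._*_
  ; -_                = ℤ.-_
  ; 0#                = + 0
  ; 1#                = + 1
  ; isCommutativeRing = record
    { isRing = record
      { +-isAbelianGroup = record
        { isGroup = record
          { isMonoid = record
            { isSemigroup = record
              { isMagma = record
                { isEquivalence = record
                  { refl  = λ {a} → ≡⇒mod {a} ≡.refl
                  ; sym   = λ {a} {b} d →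
                      ≡.subst (+ p ∣_) (sym-eq a b) (ℤ∣.∣m⇒∣-m d)
                  ; trans = λ {a} {b} {c} d e →
                      ≡.subst (+ p ∣_) (trans-eq a b c) (ℤ∣.∣m∣n⇒∣m+n d e)
                  }
                ; ∙-cong = λ {a} {b} {c} {d} x y →
                    ≡.subst (+ p ∣_) (+-eq a b c d) (ℤ∣.∣m∣n⇒∣m+n x y)
                }
              ; assoc = λ a b c → ≡⇒mod (ℤ.+-assoc a b c)
              }
            ; identity = (λ a → ≡⇒mod (ℤ.+-identityˡ a))
                       , (λ a → ≡⇒mod (ℤ.+-identityʳ a))
            }
          ; inverse = (λ a → ≡⇒mod (ℤ.+-inverseˡ a))
                    , (λ a → ≡⇒mod (ℤ.+-inverseʳ a))
          ; ⁻¹-cong = λ {a} {b} d →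
              ≡.subst (+ p ∣_) (neg-eq a b) (ℤ∣.∣m⇒∣-m d)
          }
        ; comm = λ a b → ≡⇒mod (ℤ.+-comm a b)
        }
      ; *-cong = λ {a} {b} {c} {d} x y →
          ≡.subst (+ p ∣_) (*-eq a b c d)
            (ℤ∣.∣m∣n⇒∣m+n (ℤ∣.∣m⇒∣m*n c x) (ℤ∣.∣n⇒∣m*n b y))
      ; *-assoc = λ a b c → ≡⇒mod (ℤ.*-assoc a b c)
      ; *-identity = (λ a → ≡⇒mod (ℤ.*-identityˡ a))
                   , (λ a → ≡⇒mod (ℤ.*-identityʳ a))
      ; distrib = (λ a b c → ≡⇒mod (ℤ.*-distribˡ-+ a b c))
                , (λ a b c → ≡⇒mod (ℤ.*-distribʳ-+ a b c))
      }
    ; *-comm = λ a b → ≡⇒mod (ℤ.*-comm a b)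
    }
  }
  where
  ≡⇒mod : ∀ {a b} → a ≡ b → a ≡ b [mod p ]
  ≡⇒mod {a} ≡.refl = ≡.subst (+ p ∣_) (≡.sym (ℤ.+-inverseʳ a)) (ℤ∣.divides 0ℤ ≡.refl)

  sym-eq : ∀ a b → ℤ.- (a ℤ.- b) ≡ b ℤ.- a
  sym-eq = solve-∀
  trans-eq : ∀ a b c → (a ℤ.- b) ℤ.+ (b ℤ.- c) ≡ a ℤ.- c
  trans-eq = solve-∀
  +-eq : ∀ a b c d → (a ℤ.- b) ℤ.+ (c ℤ.- d) ≡ (a ℤ.+ c) ℤ.- (b ℤ.+ d)
  +-eq = solve-∀
  neg-eq : ∀ a b → ℤ.- (a ℤ.- b) ≡ (ℤ.- a) ℤ.- (ℤ.- b)
  neg-eq = solve-∀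
  *-eq : ∀ a b c d → (a ℤ.- b) ℤ.* c ℤ.+ b ℤ.* (c ℤ.- d) ≡ a ℤ.* c ℤ.- b ℤ.* d
  *-eq = solve-∀

module ℤ[x] = Polynomials ℤ.+-*-commutativeRing
module ℚ[x] = Polynomials ℚ.+-*-commutativeRing
module 𝔽[x] (p : ℕ) = Polynomials (𝔽 p)

fromℤ : ℤ → ℚ
fromℤ a = a ℚ./ 1

fromℤ-nonZero : ∀ {a} → a ≢ 0ℤ → ℚ.NonZero (fromℤ a)
fromℤ-nonZero {a} a≢0 = ℚ.≢-nonZero λ a/1≡0 →
  case ℚ./-injective-≃ (mkℚᵘ a 0) (mkℚᵘ 0ℤ 0) a/1≡0 of λ where
    (*≡* a*1≡0) → a≢0 (≡.trans (≡.sym (ℤ.*-identityʳ a)) a*1≡0)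

toℚ[x] : ℤ[x].Poly → ℚ[x].Poly
toℚ[x] = map fromℤ

reduce : ∀ p → ℤ[x].Poly → 𝔽[x].Poly p
reduce p = map id

Separable : ℤ[x].Poly → Set
Separable f = ℚ[x].CoprimeToDerivative (toℚ[x] f)

record Good (p n : ℕ) .{{_ : NonZero n}} (f : ℤ[x].Poly) : Set where
  field
    prime       : Prime p
    odd         : p ≢ 2
    same-degree : 𝔽[x].HasDegree p n (reduce p f)
    disc≢0      : ¬ 𝔽[x].disc p n (reduce p f) ≡ 0ℤ [mod p ]

Squarefree : ℤ → Set
Squarefree d = d ≢ 0ℤ × (∀ k → k ℤ.* k ∣ d → ∣ k ∣ ≡ 1)

-- The graph of S: d is squarefree and r / d is a square in ℚ.
IsSquarefreePart : ℚ → ℤ → Set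
IsSquarefreePart r d =
  Σ (Squarefree d) λ (d≢0 , _) →
    ∃ λ s → (r ℚ.÷ fromℤ d) {{fromℤ-nonZero d≢0}} ≡ s ℚ.* s

𝒮 : ℤ[x].Poly → ℤ → Set
𝒮 f d = ∃ λ r →
  let fr = ℚ[x].eval (toℚ[x] f) r in fr ≢ 0ℚ × IsSquarefreePart fr d

-- Every finite list misses an element satisfying P.
InfinitelyMany : {A : Set} → (A → Set) → Set
InfinitelyMany P = ∀ xs → ∃ λ a → P a × a ∉ xs

A : (n : ℕ) .{{_ : NonZero n}} → Set
A n = ∀ f → ℤ[x].HasDegree n f → Separable f →
      ∀ p → Good p n f →
      ∀ m → Coprime m (+ p) →
      InfinitelyMany λ d → 𝒮 f d × d ≡ m [mod p ]

P : (n : ℕ) .{{_ : NonZero n}} → Set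
P n = ∀ h → ℤ[x].HasDegree n h → Separable h →
      (∃ λ a → ℤ[x].coeff h n ≡ a ℤ.* a) →
      ∀ p → Good p n h →
      ∀ m → Coprime m (+ p) →
      InfinitelyMany λ q → Prime q × 𝒮 h (+ q) × + q ≡ m [mod p ]

{-# OPTIONS --safe #-}

-- Write the leading coefficient of f as c b² with c squarefree, and put
-- h = c f.  Then h is separable with square leading coefficient (c b)², and it
-- is good at p because disc h is a power of c times disc f.  If q is a prime in
-- 𝒮 h not dividing c, then c q is squarefree and f(r) = c q (s/c)² whenever
-- h(r) = q s², so c q ∈ 𝒮 f.  Choosing q ≡ m / c modulo p and q large gives
-- c q ≡ m and avoids any given finite list.
module Submission where

open import Defs
open import Algebra.Bundles using (CommutativeRing; Semiring)
import Algebra.Properties.CommutativeSemigroup as CommutativeSemigroupProperties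
import Algebra.Properties.Semiring.Mult as SemiringMult
import Algebra.Properties.Semiring.Sum as SemiringSum
open import Data.Fin.Base using (Fin; zero; suc; toℕ; punchIn; splitAt)
open import Data.Integer.Base as ℤ using (ℤ; +_; 0ℤ; 1ℤ; ∣_∣)
open import Data.Integer.Coprimality using (Coprime)
open import Data.Integer.Divisibility.Signed as ℤ∣ using (_∣_; divides; ∣ᵤ⇒∣; ∣⇒∣ᵤ)
import Data.Integer.Properties as ℤ
open import Data.Integer.Tactic.RingSolver using (solve-∀)
open import Data.List.Base using ([]; _∷_; map; upTo)
open import Data.List.Extrema.Nat using (max; xs≤max; ⊥≤max)
open import Data.List.Membership.Propositional using (_∉_)
open import Data.List.Membership.Propositional.Properties using (∈-map⁺; ∈-upTo⁺)
open import Data.List.Properties using (map-∘; map-cong)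
open import Data.List.Relation.Binary.Pointwise
  using (Pointwise; []; _∷_; Pointwise-≡⇒≡)
import Data.List.Relation.Unary.All as All
open import Data.Nat.Base as ℕ
  using (ℕ; zero; suc; NonZero)
import Data.Nat.Coprimality as ℕ
open import Data.Nat.Divisibility as ℕ∣ using (∣⇒≤)
open import Data.Nat.GCD using (module Bézout)
open import Data.Nat.Induction using (<-wellFounded)
open import Data.Nat.Primality
  using (Prime; euclidsLemma; prime⇒irreducible; prime⇒nonZero; prime⇒nonTrivial)
import Data.Nat.Properties as ℕ
open import Data.Product.Base using (∃; ∃₂; _×_; _,_; proj₁; proj₂)
open import Data.Rational.Base as ℚ using (ℚ; 0ℚ; 1ℚ)
import Data.Rational.Properties as ℚ
open import Data.Rational.Solver using (module +-*-Solver)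
open import Data.Rational.Unnormalised.Base using (mkℚᵘ)
import Data.Rational.Unnormalised.Base as ℚᵘ
import Data.Rational.Unnormalised.Properties as ℚᵘ
open import Data.Sum.Base using (inj₁; inj₂; fromInj₁)
open import Function.Base using (id)
open import Induction.WellFounded using (Acc; acc)
open import Level using (Level; _⊔_)
open import Relation.Binary.PropositionalEquality as ≡ using (_≡_; _≢_)
open import Relation.Nullary.Decidable using (yes; no; _×-dec_)
open import Relation.Nullary.Negation using (¬_; contradiction)

module Scaling {a ℓ : Level} (R : CommutativeRing a ℓ)
               (c : CommutativeRing.Carrier R) where

  open CommutativeRing R hiding (zero)
  open Polynomials R
  open import Algebra.Definitions.RawSemiring (Semiring.rawSemiring semiring) using (_^_)
  open SemiringMult semiring using (×-comm-*) renaming (_×_ to _·_)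
  open SemiringSum semiring using (sum; sum-cong-≋; *-distribˡ-sum)
  open CommutativeSemigroupProperties *-commutativeSemigroup
    using (interchange; x∙yz≈y∙xz)
  open import Relation.Binary.Reasoning.Setoid setoid

  scale : Poly → Poly
  scale = map (c *_)

  Cancellable : Set (a ⊔ ℓ)
  Cancellable = ∀ x → c * x ≈ 0# → x ≈ 0#

  coeff-scale : ∀ f i → coeff (scale f) i ≈ c * coeff f i
  coeff-scale []      i       = sym (zeroʳ c)
  coeff-scale (x ∷ f) zero    = refl
  coeff-scale (x ∷ f) (suc i) = coeff-scale f i

  eval-scale : ∀ f x → eval (scale f) x ≈ c * eval f x
  eval-scale []      x = sym (zeroʳ c)
  eval-scale (y ∷ f) x = begin
    c * y + x * eval (scale f) x  ≈⟨ +-congˡ (*-congˡ (eval-scale f x)) ⟩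
    c * y + x * (c * eval f x)    ≈⟨ +-congˡ (x∙yz≈y∙xz x c _) ⟩
    c * y + c * (x * eval f x)    ≈⟨ distribˡ c y _ ⟨
    c * (y + x * eval f x)        ∎

  derivative-scale : ∀ f → Pointwise _≈_ (derivative (scale f)) (scale (derivative f))
  derivative-scale []      = []
  derivative-scale (_ ∷ f) = scaleFrom-scale 1 f
    where
    scaleFrom-scale : ∀ i f →
      Pointwise _≈_ (scaleFrom i (scale f)) (scale (scaleFrom i f))
    scaleFrom-scale i []      = []
    scaleFrom-scale i (x ∷ f) = sym (×-comm-* i c x) ∷ scaleFrom-scale (suc i) f

  coeff-cong : ∀ {f g} → Pointwise _≈_ f g → ∀ i → coeff f i ≈ coeff g i
  coeff-cong []          i       = refl
  coeff-cong (x≈y ∷ f≈g) zero    = x≈y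
  coeff-cong (x≈y ∷ f≈g) (suc i) = coeff-cong f≈g i

  coeff-derivative-scale : ∀ f i →
    coeff (derivative (scale f)) i ≈ c * coeff (derivative f) i
  coeff-derivative-scale f i =
    trans (coeff-cong (derivative-scale f) i) (coeff-scale (derivative f) i)

  hasDegree-scale : Cancellable → ∀ {n f} → HasDegree n f → HasDegree n (scale f)
  hasDegree-scale cancel {n} {f} (fₙ≉0 , f>n≈0) =
    (λ e → fₙ≉0 (cancel _ (trans (sym (coeff-scale f n)) e))) ,
    (λ i n<i → trans (coeff-scale f i) (trans (*-congˡ (f>n≈0 i n<i)) (zeroʳ c)))

  det-scale : ∀ {n} (M N : Matrix n) → (∀ i j → N i j ≈ c * M i j) →
              det N ≈ c ^ n * det M
  det-scale {zero}  M N N≈cM = sym (*-identityˡ 1#)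
  det-scale {suc n} M N N≈cM = begin
    det N
      ≈⟨ sum-cong-≋ {suc n} term ⟩
    sum (λ i → c ^ suc n * (sign (toℕ i) * (M i zero * det (minor M i))))
      ≈⟨ *-distribˡ-sum {suc n} (c ^ suc n) (λ i → sign (toℕ i) * (M i zero * det (minor M i))) ⟨
    c ^ suc n * det M ∎
    where
    term : ∀ i → sign (toℕ i) * (N i zero * det (minor N i)) ≈
                 c ^ suc n * (sign (toℕ i) * (M i zero * det (minor M i)))
    term i = begin
      sign (toℕ i) * (N i zero * det (minor N i))
        ≈⟨ *-congˡ (*-cong (N≈cM i zero)
             (det-scale (minor M i) (minor N i) λ r s → N≈cM (punchIn i r) (suc s))) ⟩
      sign (toℕ i) * ((c * M i zero) * (c ^ n * det (minor M i)))
        ≈⟨ *-congˡ (interchange c (M i zero) (c ^ n) _) ⟩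
      sign (toℕ i) * ((c * c ^ n) * (M i zero * det (minor M i)))
        ≈⟨ x∙yz≈y∙xz _ _ _ ⟩
      c ^ suc n * (sign (toℕ i) * (M i zero * det (minor M i))) ∎

  det-replaceFirstColumn-scale :
    ∀ {n} (v : Fin n → Carrier) (M N : Matrix n) → (∀ i j → N i j ≈ c * M i j) →
    det (replaceFirstColumn v N) ≈ c ^ ℕ.pred n * det (replaceFirstColumn v M)
  det-replaceFirstColumn-scale {zero}  v M N N≈cM = sym (*-identityˡ 1#)
  det-replaceFirstColumn-scale {suc n} v M N N≈cM = begin
    det (replaceFirstColumn v N)
      ≈⟨ sum-cong-≋ {suc n} term ⟩
    sum (λ i → c ^ n * (sign (toℕ i) * (v i * det (minor M i))))
      ≈⟨ *-distribˡ-sum {suc n} (c ^ n) (λ i → sign (toℕ i) * (v i * det (minor M i))) ⟨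
    c ^ n * det (replaceFirstColumn v M) ∎
    where
    term : ∀ i → sign (toℕ i) * (v i * det (minor N i)) ≈
                 c ^ n * (sign (toℕ i) * (v i * det (minor M i)))
    term i = begin
      sign (toℕ i) * (v i * det (minor N i))
        ≈⟨ *-congˡ (*-congˡ
             (det-scale (minor M i) (minor N i) λ r s → N≈cM (punchIn i r) (suc s))) ⟩
      sign (toℕ i) * (v i * (c ^ n * det (minor M i)))
        ≈⟨ *-congˡ (x∙yz≈y∙xz _ _ _) ⟩
      sign (toℕ i) * (c ^ n * (v i * det (minor M i)))
        ≈⟨ x∙yz≈y∙xz _ _ _ ⟩
      c ^ n * (sign (toℕ i) * (v i * det (minor M i))) ∎

  module _ {f g : Poly} (g≈cf : ∀ i → coeff g i ≈ c * coeff f i) where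

    descending-scale : ∀ m j → descending m g j ≈ c * descending m f j
    descending-scale m       zero    = g≈cf m
    descending-scale zero    (suc j) = sym (zeroʳ c)
    descending-scale (suc m) (suc j) = descending-scale m j

    shifted-scale : ∀ i m j →
      shifted i (descending m g) j ≈ c * shifted i (descending m f) j
    shifted-scale zero    m j       = descending-scale m j
    shifted-scale (suc i) m zero    = sym (zeroʳ c)
    shifted-scale (suc i) m (suc j) = shifted-scale i m j

  sylvester-scale : ∀ m n f i j →
    sylvester m n (scale f) (derivative (scale f)) i j ≈
    c * sylvester m n f (derivative f) i j
  sylvester-scale m n f i j with splitAt n i
  ... | inj₁ k = shifted-scale {f} {scale f} (coeff-scale f) (toℕ k) m (toℕ j)
  ... | inj₂ k = shifted-scale {derivative f} {derivative (scale f)}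
                   (coeff-derivative-scale f) (toℕ k) n (toℕ j)

  disc-scale : ∀ k f → let n = suc k in
    disc n (scale f) ≈ c ^ ℕ.pred (k ℕ.+ n) * disc n f
  disc-scale k f = trans
    (*-congˡ (det-replaceFirstColumn-scale (dividedColumn k) _ _ (sylvester-scale (suc k) k f)))
    (x∙yz≈y∙xz _ _ _)

  ^-cancellable : Cancellable → ∀ j x → c ^ j * x ≈ 0# → x ≈ 0#
  ^-cancellable cancel zero    x e = trans (sym (*-identityˡ x)) e
  ^-cancellable cancel (suc j) x e =
    ^-cancellable cancel j x (cancel _ (trans (sym (*-assoc c _ x)) e))

  disc-scale≉0 : Cancellable → ∀ n .{{_ : NonZero n}} f →
    ¬ disc n f ≈ 0# → ¬ disc n (scale f) ≈ 0#
  disc-scale≉0 cancel (suc k) f disc≉0 e =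
    disc≉0 (^-cancellable cancel (ℕ.pred (k ℕ.+ suc k)) _ (trans (sym (disc-scale k f)) e))

module ℤ-Scaling = Scaling ℤ.+-*-commutativeRing
module ℚ-Scaling = Scaling ℚ.+-*-commutativeRing
module 𝔽-Scaling (p : ℕ) = Scaling (𝔽 p)

fromℤ-* : ∀ a b → fromℤ (a ℤ.* b) ≡ fromℤ a ℚ.* fromℤ b
fromℤ-* a b = ℚ.toℚᵘ-injective (begin
  ℚ.toℚᵘ (fromℤ (a ℤ.* b))                    ≈⟨ toℚᵘ-fromℤ (a ℤ.* b) ⟩
  mkℚᵘ a 0 ℚᵘ.* mkℚᵘ b 0                       ≈⟨ ℚᵘ.*-cong (toℚᵘ-fromℤ a) (toℚᵘ-fromℤ b) ⟨
  ℚ.toℚᵘ (fromℤ a) ℚᵘ.* ℚ.toℚᵘ (fromℤ b)        ≈⟨ ℚ.toℚᵘ-homo-* (fromℤ a) (fromℤ b) ⟨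
  ℚ.toℚᵘ (fromℤ a ℚ.* fromℤ b)                 ∎)
  where
  open import Relation.Binary.Reasoning.Setoid ℚᵘ.≃-setoid
  toℚᵘ-fromℤ : ∀ a → ℚ.toℚᵘ (fromℤ a) ℚᵘ.≃ mkℚᵘ a 0
  toℚᵘ-fromℤ a = ℚ.toℚᵘ-fromℚᵘ (mkℚᵘ a 0)

toℚ[x]-scale : ∀ c f → toℚ[x] (ℤ-Scaling.scale c f) ≡ ℚ-Scaling.scale (fromℤ c) (toℚ[x] f)
toℚ[x]-scale c f = begin
  map fromℤ (map (c ℤ.*_) f)            ≡⟨ map-∘ f ⟨
  map (λ a → fromℤ (c ℤ.* a)) f         ≡⟨ map-cong (fromℤ-* c) f ⟩
  map (λ a → fromℤ c ℚ.* fromℤ a) f     ≡⟨ map-∘ f ⟩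
  map (fromℤ c ℚ.*_) (map fromℤ f)      ∎
  where open ≡.≡-Reasoning

reduce-scale : ∀ p c f → reduce p (ℤ-Scaling.scale c f) ≡ 𝔽-Scaling.scale p c (reduce p f)
reduce-scale p c f = ≡.trans (≡.sym (map-∘ f)) (map-∘ f)

scale-*ₚ-scale : ∀ d c → d ℚ.* c ≡ 1ℚ → ∀ u g →
  ℚ-Scaling.scale d u ℚ[x].*ₚ ℚ-Scaling.scale c g ≡ u ℚ[x].*ₚ g
scale-*ₚ-scale d c dc≡1 []      g = ≡.refl
scale-*ₚ-scale d c dc≡1 (x ∷ u) g =
  ≡.cong₂ (λ s t → s ℚ[x].+ₚ (0ℚ ∷ t))
    (≡.trans (≡.sym (map-∘ g)) (map-cong cancel g))
    (scale-*ₚ-scale d c dc≡1 u g)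
  where
  open ≡.≡-Reasoning
  open CommutativeSemigroupProperties
    (CommutativeRing.*-commutativeSemigroup ℚ.+-*-commutativeRing) using (interchange)
  cancel : ∀ y → (d ℚ.* x) ℚ.* (c ℚ.* y) ≡ x ℚ.* y
  cancel y = begin
    (d ℚ.* x) ℚ.* (c ℚ.* y)  ≡⟨ interchange d x c y ⟩
    (d ℚ.* c) ℚ.* (x ℚ.* y)  ≡⟨ ≡.cong (ℚ._* (x ℚ.* y)) dc≡1 ⟩
    1ℚ ℚ.* (x ℚ.* y)         ≡⟨ ℚ.*-identityˡ _ ⟩
    x ℚ.* y                  ∎

separable-scale : ∀ {c} → c ≢ 0ℤ → ∀ {f} → Separable f → Separable (ℤ-Scaling.scale c f)
separable-scale {c} c≢0 {f} (u , v , bézout) =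
  scale d u , scale d v , λ i → ≡.trans (≡.cong (λ g → ℚ[x].coeff g i) combination) (bézout i)
  where
  instance _ = fromℤ-nonZero c≢0
  open ℚ-Scaling using (scale)
  open ≡.≡-Reasoning
  d  = ℚ.1/ fromℤ c
  g  = toℚ[x] f
  g′ = ℚ[x].derivative g
  cg = scale (fromℤ c) g
  h  = toℚ[x] (ℤ-Scaling.scale c f)

  combination : (scale d u ℚ[x].*ₚ h) ℚ[x].+ₚ (scale d v ℚ[x].*ₚ ℚ[x].derivative h) ≡
                (u ℚ[x].*ₚ g) ℚ[x].+ₚ (v ℚ[x].*ₚ g′)
  combination = begin
    (scale d u ℚ[x].*ₚ h) ℚ[x].+ₚ (scale d v ℚ[x].*ₚ ℚ[x].derivative h)
      ≡⟨ ≡.cong₂ (λ s t → (scale d u ℚ[x].*ₚ s) ℚ[x].+ₚ (scale d v ℚ[x].*ₚ t))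
           (toℚ[x]-scale c f)
           (≡.trans (≡.cong ℚ[x].derivative (toℚ[x]-scale c f))
                    (Pointwise-≡⇒≡ (ℚ-Scaling.derivative-scale (fromℤ c) g))) ⟩
    (scale d u ℚ[x].*ₚ cg) ℚ[x].+ₚ (scale d v ℚ[x].*ₚ scale (fromℤ c) g′)
      ≡⟨ ≡.cong₂ ℚ[x]._+ₚ_
           (scale-*ₚ-scale d (fromℤ c) (ℚ.*-inverseˡ (fromℤ c)) u g)
           (scale-*ₚ-scale d (fromℤ c) (ℚ.*-inverseˡ (fromℤ c)) v g′) ⟩
    (u ℚ[x].*ₚ g) ℚ[x].+ₚ (v ℚ[x].*ₚ g′) ∎

ℤ-cancellable : ∀ {c} → c ≢ 0ℤ → ℤ-Scaling.Cancellable c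
ℤ-cancellable {c} c≢0 x cx≡0 with ℤ.i*j≡0⇒i≡0∨j≡0 c cx≡0
... | inj₁ c≡0 = contradiction c≡0 c≢0
... | inj₂ x≡0 = x≡0

≡0[mod]⇒∣ : ∀ {p} a → a ≡ 0ℤ [mod p ] → p ℕ∣.∣ ∣ a ∣
≡0[mod]⇒∣ a p∣a-0 = ∣⇒∣ᵤ (≡.subst (_ ∣_) (ℤ.+-identityʳ a) p∣a-0)

∣⇒≡0[mod] : ∀ {p} a → p ℕ∣.∣ ∣ a ∣ → a ≡ 0ℤ [mod p ]
∣⇒≡0[mod] a p∣a = ≡.subst (_ ∣_) (≡.sym (ℤ.+-identityʳ a)) (∣ᵤ⇒∣ p∣a)

𝔽-cancellable : ∀ {p c} → Prime p → ¬ p ℕ∣.∣ ∣ c ∣ → 𝔽-Scaling.Cancellable p c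
𝔽-cancellable {p} {c} pr p∤c x cx≡0
  with euclidsLemma ∣ c ∣ ∣ x ∣ pr
         (≡.subst (p ℕ∣.∣_) (ℤ.abs-* c x) (≡0[mod]⇒∣ (c ℤ.* x) cx≡0))
... | inj₁ p∣c = contradiction p∣c p∤c
... | inj₂ p∣x = ∣⇒≡0[mod] x p∣x

good-scale : ∀ {p n} .{{_ : NonZero n}} {f c} → ¬ p ℕ∣.∣ ∣ c ∣ →
             Good p n f → Good p n (ℤ-Scaling.scale c f)
good-scale {p} {n} {f} {c} p∤c good = record
  { prime       = prime
  ; odd         = odd
  ; same-degree = ≡.subst (𝔽[x].HasDegree p n) (≡.sym (reduce-scale p c f))
                    (𝔽-Scaling.hasDegree-scale p c cancel {n} {reduce p f} same-degree)
  ; disc≢0      = ≡.subst (λ g → ¬ 𝔽[x].disc p n g ≡ 0ℤ [mod p ])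
                    (≡.sym (reduce-scale p c f))
                    (𝔽-Scaling.disc-scale≉0 p c cancel n (reduce p f) disc≢0)
  }
  where
  open Good good
  cancel : 𝔽-Scaling.Cancellable p c
  cancel = 𝔽-cancellable {p} {c} prime p∤c

prime∤⇒coprime : ∀ {p n} → Prime p → ¬ p ℕ∣.∣ n → ℕ.Coprime n p
prime∤⇒coprime pr p∤n (d∣n , d∣p) with prime⇒irreducible pr d∣p
... | inj₁ d≡1    = d≡1
... | inj₂ ≡.refl = contradiction d∣n p∤n

coprime⇒prime∤ : ∀ {p n} → Prime p → ℕ.Coprime n p → ¬ p ℕ∣.∣ n
coprime⇒prime∤ pr n⊥p p∣n =
  ℕ.nonTrivial⇒≢1 {{prime⇒nonTrivial pr}} (n⊥p (p∣n , ℕ∣.∣-refl))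

ℤ-1+* : ∀ a b c d → 1 ℕ.+ a ℕ.* b ≡ c ℕ.* d → 1ℤ ℤ.+ + a ℤ.* + b ≡ + c ℤ.* + d
ℤ-1+* a b c d e = begin
  1ℤ ℤ.+ + a ℤ.* + b  ≡⟨ ≡.cong (ℤ._+_ 1ℤ) (ℤ.pos-* a b) ⟨
  + (1 ℕ.+ a ℕ.* b)   ≡⟨ ≡.cong +_ e ⟩
  + (c ℕ.* d)         ≡⟨ ℤ.pos-* c d ⟩
  + c ℤ.* + d         ∎
  where open ≡.≡-Reasoning

inverse-mod : ∀ {p} c → Coprime c (+ p) → ∃ λ u → c ℤ.* u ≡ 1ℤ [mod p ]
inverse-mod {p} c c⊥p with abs-inverse | ℤ.+∣i∣≡i⊎+∣i∣≡-i c
  where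
  abs-inverse : ∃ λ u → + ∣ c ∣ ℤ.* u ≡ 1ℤ [mod p ]
  abs-inverse with ℕ.coprime-Bézout c⊥p
  ... | Bézout.+- x y 1+yp≡xc = + x , divides (+ y)
    (≡.trans (≡.cong (ℤ._- 1ℤ) (≡.trans (ℤ.*-comm (+ ∣ c ∣) (+ x)) (≡.sym (ℤ-1+* y p x ∣ c ∣ 1+yp≡xc))))
             (cancel (+ y ℤ.* + p)))
    where
    cancel : ∀ k → (1ℤ ℤ.+ k) ℤ.- 1ℤ ≡ k
    cancel = solve-∀
  ... | Bézout.-+ x y 1+xc≡yp = ℤ.- (+ x) , divides (ℤ.- (+ y))
    (≡.trans (move (+ ∣ c ∣) (+ x))
      (≡.trans (≡.cong ℤ.-_ (ℤ-1+* x ∣ c ∣ y p 1+xc≡yp)) (ℤ.neg-distribˡ-* (+ y) (+ p))))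
    where
    move : ∀ c x → c ℤ.* (ℤ.- x) ℤ.- 1ℤ ≡ ℤ.- (1ℤ ℤ.+ x ℤ.* c)
    move = solve-∀
... | u , e | inj₁ ∣c∣≡c  = u , ≡.subst (λ b → b ℤ.* u ≡ 1ℤ [mod p ]) ∣c∣≡c e
... | u , e | inj₂ ∣c∣≡-c = ℤ.- u ,
  ≡.subst (λ b → b ≡ 1ℤ [mod p ]) (≡.trans (≡.cong (ℤ._* u) ∣c∣≡-c) (flip-sign c u)) e
  where
  flip-sign : ∀ c u → ℤ.- c ℤ.* u ≡ c ℤ.* (ℤ.- u)
  flip-sign = solve-∀

quotient-mod : ∀ {p c m} → Prime p → ¬ p ℕ∣.∣ ∣ c ∣ → Coprime m (+ p) →
  ∃ λ k → Coprime k (+ p) × (∀ q → q ≡ k [mod p ] → c ℤ.* q ≡ m [mod p ])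
quotient-mod {p} {c} {m} pr p∤c m⊥p =
  k , prime∤⇒coprime pr p∤k , λ q q≡k → ≡.subst (+ p ∣_) (cq-eq c q u m)
    (ℤ∣.∣m∣n⇒∣m+n (ℤ∣.∣n⇒∣m*n c q≡k) (ℤ∣.∣m⇒∣m*n m cu≡1))
  where
  inverse = inverse-mod c (prime∤⇒coprime pr p∤c)
  u       = proj₁ inverse
  cu≡1    = proj₂ inverse
  k       = u ℤ.* m

  k-eq : ∀ c u m → c ℤ.* (u ℤ.* m) ℤ.- (c ℤ.* u ℤ.- 1ℤ) ℤ.* m ≡ m
  k-eq = solve-∀

  cq-eq : ∀ c q u m → c ℤ.* (q ℤ.- u ℤ.* m) ℤ.+ (c ℤ.* u ℤ.- 1ℤ) ℤ.* m ≡ c ℤ.* q ℤ.- m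
  cq-eq = solve-∀

  p∤k : ¬ p ℕ∣.∣ ∣ k ∣
  p∤k p∣k = coprime⇒prime∤ pr m⊥p (∣⇒∣ᵤ (≡.subst (+ p ∣_) (k-eq c u m)
    (ℤ∣.∣m∣n⇒∣m-n (ℤ∣.∣n⇒∣m*n c (∣ᵤ⇒∣ {+ p} {k} p∣k)) (ℤ∣.∣m⇒∣m*n m cu≡1))))

squarefree-* : ∀ {c q} → Squarefree c → Prime q → ¬ q ℕ∣.∣ ∣ c ∣ → Squarefree (c ℤ.* + q)
squarefree-* {c} {q} (c≢0 , c-sqf) q-prime q∤c = cq≢0 , cq-sqf
  where
  instance _ = prime⇒nonZero q-prime
  cq≢0 : c ℤ.* + q ≢ 0ℤ
  cq≢0 cq≡0 with ℤ.i*j≡0⇒i≡0∨j≡0 c cq≡0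
  ... | inj₁ c≡0    = c≢0 c≡0
  ... | inj₂ ≡.refl = contradiction q-prime λ ()

  cq-sqf : ∀ k → k ℤ.* k ∣ c ℤ.* + q → ∣ k ∣ ≡ 1
  cq-sqf k k²∣cq = c-sqf k (∣ᵤ⇒∣ (≡.subst (ℕ∣._∣ ∣ c ∣) (≡.sym (ℤ.abs-* k k))
    (ℕ.coprime-divisor (prime∤⇒coprime q-prime q∤k²)
      (≡.subst (∣ k ∣ ℕ.* ∣ k ∣ ℕ∣.∣_) (ℕ.*-comm ∣ c ∣ q) k²∣cqᵤ))))
    where
    k²∣cqᵤ : ∣ k ∣ ℕ.* ∣ k ∣ ℕ∣.∣ ∣ c ∣ ℕ.* q
    k²∣cqᵤ = ≡.subst₂ ℕ∣._∣_ (ℤ.abs-* k k) (ℤ.abs-* c (+ q)) (∣⇒∣ᵤ k²∣cq)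

    q∤k² : ¬ q ℕ∣.∣ ∣ k ∣ ℕ.* ∣ k ∣
    q∤k² q∣k² = q∤c (ℕ∣.*-cancelʳ-∣ q (ℕ∣.∣-trans (ℕ∣.*-pres-∣ q∣k q∣k) k²∣cqᵤ))
      where
      q∣k : q ℕ∣.∣ ∣ k ∣
      q∣k = fromInj₁ id (euclidsLemma ∣ k ∣ ∣ k ∣ q-prime q∣k²)

squarefree-decomposition : ∀ a → a ≢ 0ℤ → ∃₂ λ c b → Squarefree c × a ≡ c ℤ.* (b ℤ.* b)
squarefree-decomposition a = go a (<-wellFounded ∣ a ∣)
  where
  go : ∀ a → Acc ℕ._<_ ∣ a ∣ → a ≢ 0ℤ → ∃₂ λ c b → Squarefree c × a ≡ c ℤ.* (b ℤ.* b)
  go a (acc rec) a≢0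
    with ℕ.anyUpTo? (λ k → ℕ.nonTrivial? k ×-dec (+ k ℤ.* + k) ℤ∣.∣? a) (suc ∣ a ∣)
  ... | yes (k , _ , k>1 , divides a′ a≡a′k²) =
    let c , b , c-sqf , a′≡cb² = go a′ (rec a′<a) a′≢0
    in c , b ℤ.* + k , c-sqf ,
       ≡.trans a≡a′k² (≡.trans (≡.cong (ℤ._* (+ k ℤ.* + k)) a′≡cb²) (regroup c b (+ k)))
    where
    regroup : ∀ c b k → c ℤ.* (b ℤ.* b) ℤ.* (k ℤ.* k) ≡ c ℤ.* (b ℤ.* k ℤ.* (b ℤ.* k))
    regroup = solve-∀

    a′≢0 : a′ ≢ 0ℤ
    a′≢0 ≡.refl = a≢0 a≡a′k²

    ∣a∣≡ : ∣ a ∣ ≡ ∣ a′ ∣ ℕ.* (k ℕ.* k)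
    ∣a∣≡ = ≡.trans (≡.cong ∣_∣ a≡a′k²)
             (≡.trans (ℤ.abs-* a′ _) (≡.cong (∣ a′ ∣ ℕ.*_) (ℤ.abs-* (+ k) (+ k))))

    a′<a : ∣ a′ ∣ ℕ.< ∣ a ∣
    a′<a = ≡.subst (∣ a′ ∣ ℕ.<_) (≡.sym ∣a∣≡)
      (ℕ.m<m*n ∣ a′ ∣ (k ℕ.* k) {{ℤ.≢-nonZero a′≢0}}
        (ℕ.*-mono-< (ℕ.nonTrivial⇒n>1 k {{k>1}}) (ℕ.nonTrivial⇒n>1 k {{k>1}})))
  ... | no no-square = a , 1ℤ , (a≢0 , a-sqf) , ≡.sym (ℤ.*-identityʳ a)
    where
    instance _ = ℤ.≢-nonZero a≢0
    a-sqf : ∀ k → k ℤ.* k ∣ a → ∣ k ∣ ≡ 1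
    a-sqf k k²∣a = cases ∣ k ∣ (≡.subst (ℕ∣._∣ ∣ a ∣) (ℤ.abs-* k k) (∣⇒∣ᵤ k²∣a))
      where
      cases : ∀ k → k ℕ.* k ℕ∣.∣ ∣ a ∣ → k ≡ 1
      cases 0 0∣a = contradiction (ℤ.∣i∣≡0⇒i≡0 (ℕ∣.0∣⇒≡0 0∣a)) a≢0
      cases 1 _   = ≡.refl
      cases k@(suc (suc _)) k²∣a = contradiction
        (k , ℕ.s≤s (ℕ.≤-trans (ℕ.m≤m*n k k) (∣⇒≤ k²∣a)) , _ ,
          ∣ᵤ⇒∣ (≡.subst (ℕ∣._∣ ∣ a ∣) (≡.sym (ℤ.abs-* (+ k) (+ k))) k²∣a))
        no-square

÷≡⇒≡* : ∀ {x y} d .{{_ : ℚ.NonZero d}} → x ℚ.÷ d ≡ y → x ≡ y ℚ.* d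
÷≡⇒≡* {x} {y} d e = begin
  x                      ≡⟨ ℚ.*-identityʳ x ⟨
  x ℚ.* 1ℚ               ≡⟨ ≡.cong (x ℚ.*_) (ℚ.*-inverseˡ d) ⟨
  x ℚ.* (ℚ.1/ d ℚ.* d)   ≡⟨ ℚ.*-assoc x _ d ⟨
  (x ℚ.÷ d) ℚ.* d        ≡⟨ ≡.cong (ℚ._* d) e ⟩
  y ℚ.* d                ∎
  where open ≡.≡-Reasoning

≡*⇒÷≡ : ∀ {x y} d .{{_ : ℚ.NonZero d}} → x ≡ y ℚ.* d → x ℚ.÷ d ≡ y
≡*⇒÷≡ {x} {y} d e = begin
  x ℚ.÷ d                ≡⟨ ≡.cong (ℚ._÷ d) e ⟩
  (y ℚ.* d) ℚ.÷ d        ≡⟨ ℚ.*-assoc y d _ ⟩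
  y ℚ.* (d ℚ.÷ d)        ≡⟨ ≡.cong (y ℚ.*_) (ℚ.*-inverseʳ d) ⟩
  y ℚ.* 1ℚ               ≡⟨ ℚ.*-identityʳ y ⟩
  y                      ∎
  where open ≡.≡-Reasoning

𝒮-scale⁻¹ : ∀ f {c q} → Squarefree (c ℤ.* q) → 𝒮 (ℤ-Scaling.scale c f) q → 𝒮 f (c ℤ.* q)
𝒮-scale⁻¹ f {c} {q} cq-sqf@(cq≢0 , _) (r , hr≢0 , (q≢0 , _) , s , hr/q≡s²) =
  r , fr≢0 , cq-sqf , s ℚ.* C⁻¹ , ≡*⇒÷≡ (fromℤ (c ℤ.* q)) {{fromℤ-nonZero cq≢0}} fr≡
  where
  open ≡.≡-Reasoning

  c≢0 : c ≢ 0ℤ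
  c≢0 ≡.refl = cq≢0 (ℤ.*-zeroˡ q)

  instance _ = fromℤ-nonZero c≢0
  C   = fromℤ c
  Q   = fromℤ q
  C⁻¹ = ℚ.1/ C
  fr  = ℚ[x].eval (toℚ[x] f) r
  hr  = ℚ[x].eval (toℚ[x] (ℤ-Scaling.scale c f)) r

  hr≡Cfr : hr ≡ C ℚ.* fr
  hr≡Cfr = ≡.trans (≡.cong (λ g → ℚ[x].eval g r) (toℚ[x]-scale c f))
                   (ℚ-Scaling.eval-scale C (toℚ[x] f) r)

  fr≢0 : fr ≢ 0ℚ
  fr≢0 fr≡0 = hr≢0 (≡.trans hr≡Cfr (≡.trans (≡.cong (C ℚ.*_) fr≡0) (ℚ.*-zeroʳ C)))

  rearrange : ∀ s d C Q → d ℚ.* (s ℚ.* s ℚ.* Q) ℚ.* (d ℚ.* C) ≡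
                          s ℚ.* d ℚ.* (s ℚ.* d) ℚ.* (C ℚ.* Q)
  rearrange = solve 4 (λ s d C Q → d :* (s :* s :* Q) :* (d :* C) :=
                                   s :* d :* (s :* d) :* (C :* Q)) ≡.refl
    where open +-*-Solver

  fr≡ : fr ≡ s ℚ.* C⁻¹ ℚ.* (s ℚ.* C⁻¹) ℚ.* fromℤ (c ℤ.* q)
  fr≡ = begin
    fr
      ≡⟨ ℚ.*-identityˡ fr ⟨
    1ℚ ℚ.* fr
      ≡⟨ ≡.cong (ℚ._* fr) (ℚ.*-inverseˡ C) ⟨
    C⁻¹ ℚ.* C ℚ.* fr
      ≡⟨ ℚ.*-assoc C⁻¹ C fr ⟩
    C⁻¹ ℚ.* (C ℚ.* fr)
      ≡⟨ ≡.cong (C⁻¹ ℚ.*_) (≡.trans (≡.sym hr≡Cfr) (÷≡⇒≡* Q {{fromℤ-nonZero q≢0}} hr/q≡s²)) ⟩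
    C⁻¹ ℚ.* (s ℚ.* s ℚ.* Q)
      ≡⟨ ℚ.*-identityʳ _ ⟨
    C⁻¹ ℚ.* (s ℚ.* s ℚ.* Q) ℚ.* 1ℚ
      ≡⟨ ≡.cong (C⁻¹ ℚ.* (s ℚ.* s ℚ.* Q) ℚ.*_) (ℚ.*-inverseˡ C) ⟨
    C⁻¹ ℚ.* (s ℚ.* s ℚ.* Q) ℚ.* (C⁻¹ ℚ.* C)
      ≡⟨ rearrange s C⁻¹ C Q ⟩
    s ℚ.* C⁻¹ ℚ.* (s ℚ.* C⁻¹) ℚ.* (C ℚ.* Q)
      ≡⟨ ≡.cong (s ℚ.* C⁻¹ ℚ.* (s ℚ.* C⁻¹) ℚ.*_) (fromℤ-* c q) ⟨
    s ℚ.* C⁻¹ ℚ.* (s ℚ.* C⁻¹) ℚ.* fromℤ (c ℤ.* q) ∎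

coeff-reduce : ∀ p f i → 𝔽[x].coeff p (reduce p f) i ≡ ℤ[x].coeff f i
coeff-reduce p []      i       = ≡.refl
coeff-reduce p (a ∷ f) zero    = ≡.refl
coeff-reduce p (a ∷ f) (suc i) = coeff-reduce p f i

good⇒∤leading : ∀ {p n} .{{_ : NonZero n}} {f} → Good p n f → ¬ p ℕ∣.∣ ∣ ℤ[x].coeff f n ∣
good⇒∤leading {p} {n} {f} good p∣a = proj₁ (Good.same-degree good)
  (≡.subst (λ a → a ≡ 0ℤ [mod p ]) (≡.sym (coeff-reduce p f n)) (∣⇒≡0[mod] (ℤ[x].coeff f n) p∣a))

lemma3p2 : (n : ℕ) .{{_ : NonZero n}} → P n → A n
lemma3p2 n Pn f deg sep p good m m⊥p xs
  with c , b , c-sqf@(c≢0 , _) , a≡cb² ← squarefree-decomposition (ℤ[x].coeff f n) (proj₁ deg)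
  = conclude (Pn h
      (ℤ-Scaling.hasDegree-scale c (ℤ-cancellable c≢0) {n} {f} deg)
      (separable-scale c≢0 {f} sep) (c ℤ.* b , leading)
      p (good-scale {f = f} {c} p∤c good) k (proj₁ (proj₂ quotient))
      (upTo (suc bound)))
  where
  open Good good using (prime)
  h = ℤ-Scaling.scale c f
  bound = max ∣ c ∣ (map ∣_∣ xs)

  leading : ℤ[x].coeff h n ≡ c ℤ.* b ℤ.* (c ℤ.* b)
  leading = ≡.trans (ℤ-Scaling.coeff-scale c f n)
                    (≡.trans (≡.cong (c ℤ.*_) a≡cb²) (regroup c b))
    where
    regroup : ∀ c b → c ℤ.* (c ℤ.* (b ℤ.* b)) ≡ c ℤ.* b ℤ.* (c ℤ.* b)
    regroup = solve-∀

  p∤c : ¬ p ℕ∣.∣ ∣ c ∣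
  p∤c p∣c = good⇒∤leading {f = f} good
    (≡.subst (p ℕ∣.∣_) (≡.sym (≡.trans (≡.cong ∣_∣ a≡cb²) (ℤ.abs-* c _)))
      (ℕ∣.∣m⇒∣m*n _ p∣c))

  quotient = quotient-mod {p} {c} {m} prime p∤c m⊥p
  k        = proj₁ quotient

  conclude : (∃ λ q → (Prime q × 𝒮 h (+ q) × + q ≡ k [mod p ]) × q ∉ upTo (suc bound)) →
             ∃ λ d → (𝒮 f d × d ≡ m [mod p ]) × d ∉ xs
  conclude (q , (q-prime , q∈𝒮h , q≡k) , q∉) =
    c ℤ.* + q ,
    ( 𝒮-scale⁻¹ f {c} {+ q} (squarefree-* c-sqf q-prime q∤c) q∈𝒮h
    , proj₂ (proj₂ quotient) (+ q) q≡k ) ,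
    cq∉xs
    where
    instance _ = ℤ.≢-nonZero c≢0

    q≰bound : ¬ q ℕ.≤ bound
    q≰bound q≤ = q∉ (∈-upTo⁺ (ℕ.s≤s q≤))

    q∤c : ¬ q ℕ∣.∣ ∣ c ∣
    q∤c q∣c = q≰bound (ℕ.≤-trans (∣⇒≤ q∣c) (⊥≤max ∣ c ∣ (map ∣_∣ xs)))

    cq∉xs : c ℤ.* + q ∉ xs
    cq∉xs cq∈xs = q≰bound (begin
      q                 ≤⟨ ℕ.m≤n*m q ∣ c ∣ ⟩
      ∣ c ∣ ℕ.* q       ≡⟨ ℤ.abs-* c (+ q) ⟨
      ∣ c ℤ.* + q ∣     ≤⟨ All.lookup (xs≤max ∣ c ∣ (map ∣_∣ xs)) (∈-map⁺ ∣_∣ cq∈xs) ⟩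
      bound             ∎)
      where open ℕ.≤-Reasoning
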